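{- Let $\Gamma$ be a two-ended highly-arc-transitive digraph of prime out-valency $p$ such that $m>2$, where $m$ is the common cardinality of the fibres $\varphi^{ -1}(i)$, $i\in\mathbb Z$, of a surjective digraph homomorphism $\varphi:\Gamma\to\vec{\mathbb Z}$. Then the alternets of $\Gamma$ are complete bipartite digraphs with $p$ vertices in each side, i.e. isomorphic to $\vec K_{p,p}$.
   Context: A digraph $\Gamma=(V\Gamma,E\Gamma)$ has vertex set $V\Gamma$ and arc set $E\Gamma\subseteq V\Gamma\times V\Gamma$. It is connected if its underlying undirected graph is connected. "Out-valency $p$" means that every vertex $v$ has exactly $p$ out-neighbours (vertices $u$ with $(v,u)\in E\Gamma$). A $k$-arc is a sequence of vertices $v_0,\dots,v_k$ with $(v_i,v_{i+1})\in E\Gamma$ for $0\le i<k$ (a 0-arc is a vertex). $\Gamma$ is highly-arc-transitive if $\mathrm{Aut}(\Gamma)$ is transitive on the $k$-arcs for all $k$. A ray is a one-way infinite path (in the underlying undirected graph) with distinct vertices. The ends of a digraph are the equivalence classes of rays, where two rays are equivalent if there is an infinite family of pairwise disjoint paths (ignoring directions) each having its initial vertex in one ray and terminal vertex in the other. A digraph is two-ended if it is connected and has exactly two ends. $\vec{\mathbb Z}$ is the digraph with vertex set $\mathbb Z$ and arcs $(i,i+1)$, $i\in\mathbb Z$; a digraph homomorphism is a map on vertices sending arcs to arcs (preserving direction). Every two-ended highly-arc-transitive digraph of positive out-valency admits a surjective digraph homomorphism $\varphi:\Gamma\to\vec{\mathbb Z}$, unique up to adding an integer constant, and its fibres are finite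 and all of the same size $m$. Two arcs are related if they have a common initial vertex or a common terminal vertex; the subdigraphs spanned by the classes of the transitive closure of this relation (an equivalence relation on arcs) are the alternets of $\Gamma$. $\vec K_{r,s}$ is the digraph obtained from the complete bipartite graph $K_{r,s}$ by directing all edges from the side with $r$ vertices to the side with $s$ vertices. -}

module Defs where

open import Data.Fin.Base using (Fin; zero; suc; inject₁; fromℕ)
open import Data.Integer.Base using (ℤ; 1ℤ) renaming (_+_ to _+ℤ_)
open import Data.Nat.Base using (ℕ; suc)
open import Data.Product.Base using (Σ; ∃; ∃-syntax; _×_; _,_; proj₁)
open import Data.Sum.Base using (_⊎_; inj₁; inj₂)
open import Function.Bundles using (Func; Inverse; _⇔_)
open import Function.Definitions using (Injective; Surjective)
open import Level using (Level; _⊔_) renaming (suc to lsuc; zero to lzero)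
open import Relation.Binary.Bundles using (Setoid)
open import Relation.Binary.Construct.Closure.Equivalence using (EqClosure)
open import Relation.Binary.Construct.Closure.Symmetric using (SymClosure)
open import Relation.Binary.Construct.Closure.Transitive using (TransClosure)
import Relation.Binary.Construct.On as On
open import Relation.Binary.Construct.Union using (_∪_)
open import Relation.Binary.Core using (Rel)
open import Relation.Binary.Definitions using (_Respects₂_)
open import Relation.Binary.PropositionalEquality.Core using (_≡_; _≢_; resp₂)
open import Relation.Binary.PropositionalEquality.Properties using (setoid)
open import Relation.Nullary.Negation.Core using (¬_)

private
  variable
    a c ℓ e c′ ℓ′ e′ : Level

-- A subset of a setoid is a predicate; witnesses of membership are
-- ignored by the equality, so that elements are not counted repeatedly.
Subset : (S : Setoid c ℓ) → (Setoid.Carrier S → Set a) → Setoid (c ⊔ a) ℓ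
Subset S P = On.setoid {B = Σ (Setoid.Carrier S) P} S proj₁

HasCardinality : Setoid c ℓ → ℕ → Set (c ⊔ ℓ)
HasCardinality S n = Inverse (setoid (Fin n)) S

------------------------------------------------------------------------
-- Digraphs

record Digraph c ℓ e : Set (lsuc (c ⊔ ℓ ⊔ e)) where
  infix 4 _⟶_
  field
    vertices : Setoid c ℓ
  open Setoid vertices public using (_≈_) renaming (Carrier to Vertex)
  field
    _⟶_  : Rel Vertex e
    resp : _⟶_ Respects₂ _≈_

-- Homomorphisms and isomorphisms

record Hom (Γ : Digraph c ℓ e) (Δ : Digraph c′ ℓ′ e′)
       : Set (c ⊔ ℓ ⊔ e ⊔ c′ ⊔ ℓ′ ⊔ e′) where
  private
    module Γ = Digraph Γ
    module Δ = Digraph Δ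
  field
    func : Func Γ.vertices Δ.vertices
  open Func func public using (to; cong)
  field
    preserves : ∀ {u v} → u Γ.⟶ v → to u Δ.⟶ to v

infix 4 _≅_

record _≅_ (Γ : Digraph c ℓ e) (Δ : Digraph c′ ℓ′ e′)
       : Set (c ⊔ ℓ ⊔ e ⊔ c′ ⊔ ℓ′ ⊔ e′) where
  private
    module Γ = Digraph Γ
    module Δ = Digraph Δ
  field
    inverse : Inverse Γ.vertices Δ.vertices
  open Inverse inverse public using (to; from)
  field
    arcs : ∀ {u v} → u Γ.⟶ v ⇔ to u Δ.⟶ to v

Aut : Digraph c ℓ e → Set (c ⊔ ℓ ⊔ e)
Aut Γ = Γ ≅ Γ

IsSurjective : {Γ : Digraph c ℓ e} {Δ : Digraph c′ ℓ′ e′} →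
               Hom Γ Δ → Set (c ⊔ ℓ ⊔ c′ ⊔ ℓ′)
IsSurjective {Γ = Γ} {Δ} φ =
  Surjective (Digraph._≈_ Γ) (Digraph._≈_ Δ) (Hom.to φ)

Fibre : {Γ : Digraph c ℓ e} {Δ : Digraph c′ ℓ′ e′} →
        Hom Γ Δ → Digraph.Vertex Δ → Setoid (c ⊔ ℓ′) ℓ
Fibre {Γ = Γ} {Δ} φ i =
  Subset (Digraph.vertices Γ) (λ v → Digraph._≈_ Δ (Hom.to φ v) i)

-- The directed line

ℤ⃗ : Digraph lzero lzero lzero
ℤ⃗ = record
  { vertices = setoid ℤ
  ; _⟶_      = λ i j → j ≡ i +ℤ 1ℤ
  ; resp     = resp₂ _
  }

-- The complete bipartite digraph

data BipartiteArc (r s : ℕ) : Rel (Fin r ⊎ Fin s) lzero where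
  arc : ∀ i j → BipartiteArc r s (inj₁ i) (inj₂ j)

K⃗ : ℕ → ℕ → Digraph lzero lzero lzero
K⃗ r s = record
  { vertices = setoid (Fin r ⊎ Fin s)
  ; _⟶_      = BipartiteArc r s
  ; resp     = resp₂ _
  }

------------------------------------------------------------------------
-- Notions relative to a fixed digraph

module _ (Γ : Digraph c ℓ e) where
  open Digraph Γ

  HasOutValency : ℕ → Set (c ⊔ ℓ ⊔ e)
  HasOutValency p = ∀ v → HasCardinality (Subset vertices (v ⟶_)) p

  record KArc (k : ℕ) : Set (c ⊔ e) where
    field
      vertex : Fin (suc k) → Vertex
      step   : ∀ (i : Fin k) → vertex (inject₁ i) ⟶ vertex (suc i)

  HighlyArcTransitive : Set (c ⊔ ℓ ⊔ e)
  HighlyArcTransitive =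
    ∀ k (α β : KArc k) →
    ∃[ g ] (∀ i → _≅_.to {Γ = Γ} {Δ = Γ} g (KArc.vertex α i) ≈ KArc.vertex β i)

  -- Vertices that are equal in the setoid count as joined by a walk of
  -- length zero.
  Connected : Set (c ⊔ ℓ ⊔ e)
  Connected = ∀ u v → EqClosure (_≈_ ∪ _⟶_) u v

  record Ray : Set (c ⊔ ℓ ⊔ e) where
    field
      vertex   : ℕ → Vertex
      adjacent : ∀ n → SymClosure _⟶_ (vertex n) (vertex (suc n))
      distinct : Injective _≡_ _≈_ vertex

  record Path : Set (c ⊔ ℓ ⊔ e) where
    field
      length   : ℕ
      vertex   : Fin (suc length) → Vertex
      adjacent : ∀ (i : Fin length) →
                 SymClosure _⟶_ (vertex (inject₁ i)) (vertex (suc i))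
      distinct : Injective _≡_ _≈_ vertex

    initial terminal : Vertex
    initial  = vertex zero
    terminal = vertex (fromℕ length)

  _∈ᴿ_ : Vertex → Ray → Set ℓ
  v ∈ᴿ r = ∃[ n ] v ≈ Ray.vertex r n

  Disjoint : Path → Path → Set ℓ
  Disjoint P Q = ∀ i j → ¬ (Path.vertex P i ≈ Path.vertex Q j)

  SameEnd : Rel Ray (c ⊔ ℓ ⊔ e)
  SameEnd r s =
    Σ (ℕ → Path) λ P →
      (∀ i → Path.initial (P i) ∈ᴿ r × Path.terminal (P i) ∈ᴿ s) ×
      (∀ {i j} → i ≢ j → Disjoint (P i) (P j))

  -- The double negation is needed because the end to which a ray belongs
  -- cannot be computed in general, even when there are two ends.
  ExactlyTwoEnds : Set (c ⊔ ℓ ⊔ e)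
  ExactlyTwoEnds =
    Σ Ray λ r₁ → Σ Ray λ r₂ →
      ¬ SameEnd r₁ r₂ ×
      (∀ r → ¬ ¬ (SameEnd r r₁ ⊎ SameEnd r r₂))

  TwoEnded : Set (c ⊔ ℓ ⊔ e)
  TwoEnded = Connected × ExactlyTwoEnds

  record Arc : Set (c ⊔ e) where
    field
      source target : Vertex
      isArc         : source ⟶ target

  Related : Rel Arc ℓ
  Related x y = Arc.source x ≈ Arc.source y ⊎ Arc.target x ≈ Arc.target y

  Reachable : Rel Arc (c ⊔ ℓ ⊔ e)
  Reachable = TransClosure Related

  -- The subdigraph spanned by the class of x: its arcs are those in the
  -- class and its vertices are the endpoints of these arcs.
  Alternet : Arc → Digraph (c ⊔ ℓ ⊔ e) ℓ (c ⊔ ℓ ⊔ e)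
  Alternet x = record
    { vertices = Subset vertices λ v →
        ∃[ y ] Reachable x y × (Arc.source y ≈ v ⊎ Arc.target y ≈ v)
    ; _⟶_ = λ (u , _) (v , _) →
        ∃[ y ] Reachable x y × Arc.source y ≈ u × Arc.target y ≈ v
    ; resp = (λ v≈v′ (y , x~y , s , t) → y , x~y , s , trans t v≈v′)
           , (λ u≈u′ (y , x~y , s , t) → y , x~y , trans s u≈u′ , t)
    }
    where open Setoid vertices using (trans)

{-# OPTIONS --safe #-}
module Submission where

-- Automorphisms fixing a vertex v preserve the fibres of φ, and there are
-- infinitely many of them which are told apart by a ray from v.  Two of
-- them therefore agree on the finite fibre of v, but not on some later
-- fibre.  At the first vertex u where they differ, its two images are
-- distinct and have the same in-neighbours; call such vertices twins.
-- By arc-transitivity, the twin classes within the p out-neighbours of a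
-- vertex all have the same size, which divides p and exceeds 1, hence is
-- p.  So the out-neighbours of a vertex are all twins, and the alternet
-- of s ⟶ t consists of all arcs from the in-neighbours of t to the
-- out-neighbours of s.

open import Defs
open import Algebra.Bundles using (AbelianGroup)
import Algebra.Properties.CommutativeMonoid.Sum
import Algebra.Properties.CommutativeSemigroup
open import Algebra.Properties.Group using (∙-cancelʳ)
open import Data.Bool.Base using (if_then_else_)
open import Data.Empty using (⊥)
open import Data.Fin.Base as Fin using (Fin; zero; suc; toℕ; fromℕ<; funToFin; finToFun)
open import Data.Fin.Properties as Fin using (any?; pigeonhole; injective⇒≤; finToFun-funToFin)
open import Data.Integer.Base as ℤ using (ℤ; 1ℤ)
import Data.Integer.Properties as ℤ
open import Data.Nat.Base
  using (ℕ; zero; suc; _+_; _*_; _^_; _≤_; _<_; _>_; s≤s; z≤n; z<s; NonZero; nonTrivial⇒n>1)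
open import Data.Nat.Divisibility using (_∣_; _∣0; ∣m∣n⇒∣m+n; ∣-refl)
open import Data.Nat.Primality using (Prime; prime⇒irreducible; prime⇒nonTrivial)
import Data.Nat.Properties as ℕ
open import Data.Product.Base using (Σ; ∃; ∃-syntax; _×_; _,_; proj₁; proj₂)
open import Data.Sum.Base using (_⊎_; inj₁; inj₂; [_,_]′; map₁)
open import Function.Base using (_∘_)
open import Function.Bundles using (Injection; Inverse; _⇔_; mk⇔; Equivalence)
import Function.Construct.Composition as Composition
import Function.Construct.Identity as Identity
open import Function.Properties.Inverse using (Inverse⇒Injection) renaming (sym to Inverse-sym)
open import Level using (Level; _⊔_)
open import Relation.Binary.Bundles using (Setoid)
open import Relation.Binary.Construct.Closure.Equivalence using (gfold)
open import Relation.Binary.Construct.Closure.Transitive using ([_]; _∷_)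
open import Relation.Binary.PropositionalEquality
  using (_≡_; _≢_; _≗_; refl; sym; trans; cong; cong₂; subst; isEquivalence; setoid; module ≡-Reasoning)
open import Relation.Nullary.Decidable using (Dec; yes; no; does; ¬?; map′; decidable-stable)
open import Relation.Nullary.Negation.Core using (¬_; contradiction)
open import Relation.Unary using (Pred; Decidable)

open Algebra.Properties.CommutativeMonoid.Sum ℕ.+-0-commutativeMonoid
  using (sum; sum-cong-≗; sum-replicate-zero; ∑-comm)

private
  variable
    a b c ℓ ℓ₁ ℓ₂ e q : Level
    n k d : ℕ
    A : Set a
    B : Set b

-- Counting

indicator : {P : Set a} → Dec P → ℕ
indicator P? = if does P? then 1 else 0

count : {P : Pred (Fin n) ℓ} → Decidable P → ℕ
count P? = sum (λ i → indicator (P? i))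

count-≤ : {P : Pred (Fin n) ℓ} (P? : Decidable P) → count P? ≤ n
count-≤ {zero}  P? = z≤n
count-≤ {suc n} P? with P? zero
... | yes _ = s≤s (count-≤ (P? ∘ suc))
... | no  _ = ℕ.m≤n⇒m≤1+n (count-≤ (P? ∘ suc))

count-full : {P : Pred (Fin n) ℓ} (P? : Decidable P) → count P? ≡ n → ∀ i → P i
count-full {suc n} P? eq i with P? zero
count-full {suc n} P? eq zero    | yes p = p
count-full {suc n} P? eq (suc i) | yes p = count-full (P? ∘ suc) (ℕ.suc-injective eq) i
... | no _ = contradiction (ℕ.≤-trans (ℕ.≤-reflexive (sym eq)) (count-≤ (P? ∘ suc))) ℕ.1+n≰n

count-none : {P : Pred (Fin n) ℓ} (P? : Decidable P) → (∀ i → ¬ P i) → count P? ≡ 0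
count-none {zero}  P? ¬P = refl
count-none {suc n} P? ¬P with P? zero
... | yes p = contradiction p (¬P zero)
... | no  _ = count-none (P? ∘ suc) (¬P ∘ suc)

-- Induction on `n` lists the satisfying indices in increasing order. As `Subset` ignores membership
-- witnesses, `P` need not be proof-irrelevant.
count-card : {P : Pred (Fin n) ℓ} (P? : Decidable P) →
             HasCardinality (Subset (setoid (Fin n)) P) (count P?)
count-card {zero} P? = record
  { to = λ () ; from = λ () ; to-cong = λ { {()} } ; from-cong = λ { {() , _} }
  ; inverse = (λ { {() , _} }) , λ { {()} } }
count-card {suc n} {P = P} P? with P? zero | count-card (P? ∘ suc)
... | yes p | rest = record
  { to        = to
  ; from      = from
  ; to-cong   = cong (proj₁ ∘ to)
  ; from-cong = λ {x} {y} → from-cong {x} {y}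
  ; inverse   = (λ {x} → inverseˡ {x}) , λ {k} → inverseʳ {k}
  }
  where
  module R = Inverse rest
  to : Fin (suc (count (P? ∘ suc))) → ∃ P
  to zero    = zero , p
  to (suc k) = let i , Pi = R.to k in suc i , Pi
  from : ∃ P → Fin (suc (count (P? ∘ suc)))
  from (zero  , _)  = zero
  from (suc i , Pi) = suc (R.from (i , Pi))
  from-cong : {x y : ∃ P} → proj₁ x ≡ proj₁ y → from x ≡ from y
  from-cong {zero  , _} {zero  , _} _    = refl
  from-cong {suc i , _} {suc i , _} refl = cong suc (R.from-cong refl)
  inverseˡ : ∀ {x k} → k ≡ from x → proj₁ (to k) ≡ proj₁ x
  inverseˡ {zero  , _} refl = refl
  inverseˡ {suc i , _} refl = cong suc (R.inverseˡ refl)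
  inverseʳ : ∀ {k x} → proj₁ x ≡ proj₁ (to k) → from x ≡ k
  inverseʳ {zero}  {zero  , _} _    = refl
  inverseʳ {suc k} {suc i , _} eq = cong suc (R.inverseʳ (Fin.suc-injective eq))
... | no ¬p | rest = record
  { to        = to
  ; from      = from
  ; to-cong   = cong (proj₁ ∘ to)
  ; from-cong = λ {x} {y} → from-cong {x} {y}
  ; inverse   = (λ {x} → inverseˡ {x}) , λ {k} → inverseʳ {k}
  }
  where
  module R = Inverse rest
  to : Fin (count (P? ∘ suc)) → ∃ P
  to k = let i , Pi = R.to k in suc i , Pi
  from : ∃ P → Fin (count (P? ∘ suc))
  from (zero  , p)  = contradiction p ¬p
  from (suc i , Pi) = R.from (i , Pi)
  from-cong : {x y : ∃ P} → proj₁ x ≡ proj₁ y → from x ≡ from y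
  from-cong {zero  , p} {zero  , _} _    = contradiction p ¬p
  from-cong {suc i , _} {suc i , _} refl = R.from-cong refl
  inverseˡ : ∀ {x k} → k ≡ from x → proj₁ (to k) ≡ proj₁ x
  inverseˡ {zero  , p} _    = contradiction p ¬p
  inverseˡ {suc i , _} refl = cong suc (R.inverseˡ refl)
  inverseʳ : ∀ {k x} → proj₁ x ≡ proj₁ (to k) → from x ≡ k
  inverseʳ {k} {zero  , p} _  = contradiction p ¬p
  inverseʳ {k} {suc i , _} eq = R.inverseʳ (Fin.suc-injective eq)

card-≤ : {S : Setoid a ℓ₁} {T : Setoid b ℓ₂} →
         HasCardinality S n → HasCardinality T k → Injection S T → n ≤ k
card-≤ S≅n T≅k S↣T = injective⇒≤ (Injection.injective
  (Composition.injection (Inverse⇒Injection S≅n)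
    (Composition.injection S↣T (Inverse⇒Injection (Inverse-sym T≅k)))))

card-unique : {S : Setoid a ℓ} → HasCardinality S n → HasCardinality S k → n ≡ k
card-unique {S = S} p q = ℕ.≤-antisym
  (card-≤ p q (Identity.injection S)) (card-≤ q p (Identity.injection S))

sum-const : ∀ n (c : ℕ) → sum {n} (λ _ → c) ≡ n * c
sum-const zero    c = refl
sum-const (suc n) c = cong (c +_) (sum-const n c)

∣-sum : ∀ {n} (t : Fin n → ℕ) → (∀ i → d ∣ t i) → d ∣ sum t
∣-sum {n = zero}  t h = _ ∣0
∣-sum {n = suc n} t h = ∣m∣n⇒∣m+n (h zero) (∣-sum (t ∘ suc) (h ∘ suc))

count-≡ : (i : Fin n) → count (i Fin.≟_) ≡ 1
count-≡ {suc n} zero    = cong suc (sum-replicate-zero n)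
count-≡ {suc n} (suc i) = count-≡ i

-- Double counting: each `i` lies in exactly one fibre of `f`, so the fibre sizes sum to `n`. Every
-- fibre is empty or has `d` elements, and `d` divides both 0 and `d`.
∣-uniform-fibres : (f : Fin n → Fin k) → (∀ j → count (λ i → f i Fin.≟ f j) ≡ d) → d ∣ n
∣-uniform-fibres {n} {k} {d} f uniform = subst (d ∣_) total (∣-sum _ fibre)
  where
  fibre : ∀ c → d ∣ count (λ i → f i Fin.≟ c)
  fibre c with any? (λ i → f i Fin.≟ c)
  ... | yes (j , refl) = subst (d ∣_) (sym (uniform j)) ∣-refl
  ... | no  empty      =
    subst (d ∣_) (sym (count-none (λ i → f i Fin.≟ c) (λ i eq → empty (i , eq)))) (d ∣0)

  total : sum (λ c → count (λ i → f i Fin.≟ c)) ≡ n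
  total = begin
    sum (λ c → count (λ i → f i Fin.≟ c)) ≡⟨ ∑-comm (λ c i → indicator (f i Fin.≟ c)) ⟩
    sum (λ i → count (f i Fin.≟_))        ≡⟨ sum-cong-≗ (count-≡ ∘ f) ⟩
    sum {n} (λ _ → 1)                     ≡⟨ sum-const n 1 ⟩
    n * 1                                 ≡⟨ ℕ.*-identityʳ n ⟩
    n                                     ∎
    where open ≡-Reasoning

-- Codes stand in for function extensionality: they have decidable equality and admit the pigeonhole
-- principle, while functions are compared only by `≗`.
funToFin-injective : (f g : Fin n → Fin k) → funToFin f ≡ funToFin g → f ≗ g
funToFin-injective f g eq i = begin
  f i                     ≡⟨ finToFun-funToFin f i ⟨
  finToFun (funToFin f) i ≡⟨ cong (λ x → finToFun x i) eq ⟩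
  finToFun (funToFin g) i ≡⟨ finToFun-funToFin g i ⟩
  g i                     ∎
  where open ≡-Reasoning

funToFin-cong : {f g : Fin n → Fin k} → f ≗ g → funToFin f ≡ funToFin g
funToFin-cong {n = zero}  f≗g = refl
funToFin-cong {n = suc n} f≗g = cong₂ Fin.combine (f≗g zero) (funToFin-cong (f≗g ∘ suc))

bit : Dec A → Fin 2
bit (yes _) = suc zero
bit (no  _) = zero

bit-cong : (A? : Dec A) (B? : Dec B) → A ⇔ B → bit A? ≡ bit B?
bit-cong (yes _) (yes _) _   = refl
bit-cong (no _)  (no _)  _   = refl
bit-cong (yes x) (no ¬y) A⇔B = contradiction (Equivalence.to A⇔B x) ¬y
bit-cong (no ¬x) (yes y) A⇔B = contradiction (Equivalence.from A⇔B y) ¬x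

bit-≡ : (A? : Dec A) (B? : Dec B) → bit A? ≡ bit B? → A → B
bit-≡ _       (yes y) _ _ = y
bit-≡ (no ¬x) (no _)  _ x = contradiction x ¬x

module _ {S : Setoid a ℓ} (S≅n : HasCardinality S n) where
  open Setoid S using () renaming (_≈_ to _≈_; trans to ≈-trans; sym to ≈-sym)
  private module S = Inverse S≅n

  from-injective : ∀ {x y} → S.from x ≡ S.from y → x ≈ y
  from-injective eq = ≈-trans (≈-sym (S.strictlyInverseˡ _)) (S.inverseˡ eq)

  card-≟ : ∀ x y → Dec (x ≈ y)
  card-≟ x y = map′ from-injective S.from-cong (S.from x Fin.≟ S.from y)


-- Levels and automorphisms

module _ {Γ : Digraph c ℓ e} (φ : Hom Γ ℤ⃗) where
  open Digraph Γ
  private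
    module V = Setoid vertices
    module φ = Hom φ

  source-level : ∀ {u v z} → u ⟶ v → φ.to v ≡ z ℤ.+ 1ℤ → φ.to u ≡ z
  source-level u⟶v eq =
    ∙-cancelʳ (AbelianGroup.group ℤ.+-0-abelianGroup) 1ℤ _ _ (trans (sym (φ.preserves u⟶v)) eq)

  -- Levels rise by one along each arc, so `w` would lie both one and two levels above `u`. This
  -- later keeps the two sides of an alternet disjoint.
  no-shortcut : ∀ {u v w} → u ⟶ v → v ⟶ w → u ⟶ w → ⊥
  no-shortcut {u} {v} {w} u⟶v v⟶w u⟶w = ℤ.i≢suc[i] (begin
    φ.to u          ≡⟨ source-level u⟶w (φ.preserves v⟶w) ⟩
    φ.to v          ≡⟨ φ.preserves u⟶v ⟩
    φ.to u ℤ.+ 1ℤ   ≡⟨ ℤ.+-comm (φ.to u) 1ℤ ⟩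
    1ℤ ℤ.+ φ.to u   ∎)
    where open ≡-Reasoning

  module _ (g : Aut Γ) where
    private
      module g = _≅_ {Γ = Γ} {Δ = Γ} g
      module gI = Inverse g.inverse

      shift : Vertex → ℤ
      shift v = φ.to (g.to v) ℤ.- φ.to v

    aut-injective : ∀ {u v} → g.to u ≈ g.to v → u ≈ v
    aut-injective eq = V.trans (V.sym (gI.inverseʳ V.refl)) (gI.inverseʳ eq)

    aut-preserves : ∀ {u v} → u ⟶ v → g.to u ⟶ g.to v
    aut-preserves = Equivalence.to g.arcs

    aut-reflects : ∀ {u v} → g.to u ⟶ g.to v → u ⟶ v
    aut-reflects = Equivalence.from g.arcs

    -- Along an arc both `φ.to` and `φ.to` after `g` grow by one, so their difference does not
    -- change; connectedness spreads this to all vertices.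
    shift-constant : Connected Γ → ∀ u v → shift u ≡ shift v
    shift-constant connected u v = gfold isEquivalence shift step (connected u v)
      where
      cancel : ∀ x y → (x ℤ.+ 1ℤ) ℤ.- (y ℤ.+ 1ℤ) ≡ x ℤ.- y
      cancel x y = begin
        (x ℤ.+ 1ℤ) ℤ.- (y ℤ.+ 1ℤ)            ≡⟨ cong (λ i → (x ℤ.+ 1ℤ) ℤ.+ i) (ℤ.neg-distrib-+ y 1ℤ) ⟩
        (x ℤ.+ 1ℤ) ℤ.+ (ℤ.- y ℤ.+ ℤ.- 1ℤ)    ≡⟨ interchange x 1ℤ (ℤ.- y) (ℤ.- 1ℤ) ⟩
        (x ℤ.- y) ℤ.+ (1ℤ ℤ.- 1ℤ)            ≡⟨ ℤ.+-identityʳ (x ℤ.- y) ⟩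
        x ℤ.- y                              ∎
        where
        open ≡-Reasoning
        open Algebra.Properties.CommutativeSemigroup
          ℤ.+-commutativeSemigroup using (interchange)
      step : ∀ {x y} → x ≈ y ⊎ x ⟶ y → shift x ≡ shift y
      step (inj₁ x≈y) = cong₂ ℤ._-_ (φ.cong (gI.to-cong x≈y)) (φ.cong x≈y)
      step {x} {y} (inj₂ x⟶y) = sym (trans
        (cong₂ ℤ._-_ (φ.preserves (aut-preserves x⟶y)) (φ.preserves x⟶y))
        (cancel (φ.to (g.to x)) (φ.to x)))

    preserves-level : Connected Γ → ∀ {u} → g.to u ≈ u → ∀ v → φ.to (g.to v) ≡ φ.to v
    preserves-level connected {u} gu≈u v = ℤ.i-j≡0⇒i≡j _ _ (trans
      (shift-constant connected v u) (ℤ.i≡j⇒i-j≡0 (φ.cong gu≈u)))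

-- Enumeration of fibres and neighbours

module _ {Γ : Digraph c ℓ e} {p m : ℕ}
         (connected : Connected Γ) (hat : HighlyArcTransitive Γ)
         (prime-p : Prime p) (outs : HasOutValency Γ p) (φ : Hom Γ ℤ⃗)
         (fibres : ∀ i → HasCardinality (Fibre φ i) m) where
  open Digraph Γ
  private
    module V = Setoid vertices
    module φ = Hom φ
    module Fib z = Inverse (fibres z)
    module Out v = Inverse (outs v)

    infixl 6 _·_
    _·_ : Aut Γ → Vertex → Vertex
    g · v = _≅_.to {Γ = Γ} {Δ = Γ} g v

    ·-cong : ∀ (g : Aut Γ) {u v} → u ≈ v → g · u ≈ g · v
    ·-cong g = Inverse.to-cong (_≅_.inverse {Γ = Γ} {Δ = Γ} g)

    ·-arc : ∀ (g : Aut Γ) {u v} → u ⟶ v → g · u ⟶ g · v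
    ·-arc = aut-preserves φ

    respʳ : ∀ {u v w} → v ≈ w → u ⟶ v → u ⟶ w
    respʳ = proj₁ resp

    respˡ : ∀ {u v w} → v ≈ w → v ⟶ u → w ⟶ u
    respˡ = proj₂ resp

  vert : ℤ → Fin m → Vertex
  vert z k = proj₁ (Fib.to z k)

  level-vert : ∀ z k → φ.to (vert z k) ≡ z
  level-vert z k = proj₂ (Fib.to z k)

  vert-index : ∀ {z v} (eq : φ.to v ≡ z) → vert z (Fib.from z (v , eq)) ≈ v
  vert-index {z} eq = Fib.strictlyInverseˡ z (_ , eq)

  out : (v : Vertex) → Fin p → Vertex
  out v k = proj₁ (Out.to v k)

  out-arc : ∀ v k → v ⟶ out v k
  out-arc v k = proj₂ (Out.to v k)

  out-index : ∀ {v u} (v⟶u : v ⟶ u) → out v (Out.from v (u , v⟶u)) ≈ u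
  out-index {v} v⟶u = Out.strictlyInverseˡ v (_ , v⟶u)

  out-injective : ∀ {v j k} → out v j ≈ out v k → j ≡ k
  out-injective {v} {j} eq =
    trans (sym (Out.strictlyInverseʳ v j)) (Out.inverseʳ v {y = Out.to v j} eq)

  infix 4 _≈?_ _⟶?_

  -- Decidability is derived, not assumed: levels are compared first, then the indices within a
  -- finite fibre. Adjacency is then decided by searching the `p` out-neighbours.
  _≈?_ : ∀ u v → Dec (u ≈ v)
  u ≈? v with φ.to u ℤ.≟ φ.to v
  ... | yes eq = card-≟ (fibres (φ.to v)) (u , eq) (v , refl)
  ... | no neq = no (neq ∘ φ.cong)

  _⟶?_ : ∀ u v → Dec (u ⟶ v)
  u ⟶? v = map′ (λ (k , eq) → respʳ eq (out-arc u k)) (λ u⟶v → _ , out-index u⟶v)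
                (any? (λ k → out u k ≈? v))

  -- A property confined to one level can be counted along the enumeration of that fibre. In- and
  -- out-neighbourhoods are both of this kind, which makes their sizes comparable by sums over
  -- `Fin m`.
  level-card : ∀ z {P : Vertex → Set q} → (∀ {u v} → u ≈ v → P u → P v) →
               (P? : ∀ v → Dec (P v)) → (∀ {v} → P v → φ.to v ≡ z) →
               HasCardinality (Subset vertices P) (count (P? ∘ vert z))
  level-card z {P} P-resp P? P-level = record
    { to        = λ k → let i , Pi = C.to k in vert z i , Pi
    ; from      = from
    ; to-cong   = λ { refl → V.refl }
    ; from-cong = λ {x} {y} → C.from-cong {index x} {index y} ∘ Fib.from-cong z
    ; inverse   = (λ { {v , Pv} refl →
                      V.trans (V.reflexive (cong (vert z) (C.strictlyInverseˡ (index (v , Pv)))))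
                              (vert-index (P-level Pv)) })
                , λ {k} {x} eq → C.inverseʳ {k} {index x}
                      (Fib.inverseʳ z eq)
    }
    where
    module C = Inverse (count-card (P? ∘ vert z))
    index : Σ Vertex P → Σ (Fin m) (P ∘ vert z)
    index (v , Pv) = Fib.from z (v , P-level Pv) , P-resp (V.sym (vert-index (P-level Pv))) Pv
    from : Σ Vertex P → Fin (count (P? ∘ vert z))
    from = C.from ∘ index

  -- Transitivity on 0-arcs and 1-arcs

  pathArc : ∀ k (f : ℕ → Vertex) → (∀ i → f i ⟶ f (suc i)) → KArc Γ k
  pathArc k f arcs = record
    { vertex = f ∘ toℕ
    ; step   = λ i → subst (λ j → f j ⟶ f (suc (toℕ i))) (sym (Fin.toℕ-inject₁ i)) (arcs (toℕ i))
    }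

  vertex-transitive : ∀ u v → ∃[ g ] g · u ≈ v
  vertex-transitive u v =
    let g , eq = hat 0 (record { vertex = λ _ → u ; step = λ () })
                       (record { vertex = λ _ → v ; step = λ () })
    in g , eq zero

  private
    arc₁ : ∀ {u v} → u ⟶ v → KArc Γ 1
    arc₁ {u} {v} u⟶v = record
      { vertex = λ { zero → u ; (suc _) → v } ; step = λ { zero → u⟶v } }

  arc-transitive : ∀ {u v u′ v′} → u ⟶ v → u′ ⟶ v′ → ∃[ g ] g · u ≈ u′ × g · v ≈ v′
  arc-transitive α β =
    let g , eq = hat 1 (arc₁ α) (arc₁ β) in g , eq zero , eq (suc zero)

  -- Twins

  Twin : Vertex → Vertex → Set _
  Twin u v = ∀ w → w ⟶ u ⇔ w ⟶ v

  twin-resp : ∀ {u v u′ v′} → u ≈ u′ → v ≈ v′ → Twin u v → Twin u′ v′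
  twin-resp u≈u′ v≈v′ tw w = mk⇔
    (respʳ v≈v′ ∘ Equivalence.to (tw w) ∘ respʳ (V.sym u≈u′))
    (respʳ u≈u′ ∘ Equivalence.from (tw w) ∘ respʳ (V.sym v≈v′))

  private
    undo : ∀ (g : Aut Γ) w → g · (_≅_.from {Γ = Γ} {Δ = Γ} g w) ≈ w
    undo g w = Inverse.strictlyInverseˡ (_≅_.inverse {Γ = Γ} {Δ = Γ} g) w

  ≈⇒twin : ∀ {u v} → u ≈ v → Twin u v
  ≈⇒twin u≈v w = mk⇔ (respʳ u≈v) (respʳ (V.sym u≈v))

  twin-aut : ∀ (g : Aut Γ) {u v} → Twin u v → Twin (g · u) (g · v)
  twin-aut g {u} {v} tw w = mk⇔ (move u v (Equivalence.to (tw w′))) (move v u (Equivalence.from (tw w′)))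
    where
    w′ : Vertex
    w′ = _≅_.from {Γ = Γ} {Δ = Γ} g w
    move : ∀ x y → (w′ ⟶ x → w′ ⟶ y) → w ⟶ g · x → w ⟶ g · y
    move x y h w⟶gx = respˡ (undo g w) (·-arc g
      (h (aut-reflects φ g (respˡ (V.sym (undo g w)) w⟶gx))))

  record DistinctTwins : Set (c ⊔ ℓ ⊔ e) where
    field
      {u v}    : Vertex
      distinct : ¬ u ≈ v
      twin     : Twin u v

  -- Automorphisms that agree on a fibre

  module _ (g h : Aut Γ) where

    Agree : ℤ → Set _
    Agree z = ∀ w → φ.to w ≡ z → g · w ≈ h · w

    -- An in-neighbour `w` of `g · u` is the image under `g` of an in-neighbour of `u`, which lies
    -- at level `z`. There `h` has the same value, so `h` carries the same arc to one from `w` to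
    -- `h · u`.
    images-twin : ∀ {u z} → Agree z → φ.to u ≡ z ℤ.+ 1ℤ → Twin (g · u) (h · u)
    images-twin {u} agree level w = mk⇔
      (λ w⟶gu → let a = pull g w⟶gu in
        respˡ (V.trans (V.sym (agree _ (source-level φ a level))) (undo g w)) (·-arc h a))
      (λ w⟶hu → let a = pull h w⟶hu in
        respˡ (V.trans (agree _ (source-level φ a level)) (undo h w)) (·-arc g a))
      where
      pull : ∀ (f : Aut Γ) → w ⟶ f · u → _≅_.from {Γ = Γ} {Δ = Γ} f w ⟶ u
      pull f w⟶fu = aut-reflects φ f (respˡ (V.sym (undo f w)) w⟶fu)

    -- The next fibre is finite and equality is decidable, so a vertex with two different images can
    -- be searched for; its images are the required twins.
    agree-step : ∀ z → Agree z → Agree (z ℤ.+ 1ℤ) ⊎ DistinctTwins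
    agree-step z agree with any? (λ k → ¬? (g · vert (z ℤ.+ 1ℤ) k ≈? h · vert (z ℤ.+ 1ℤ) k))
    ... | yes (k , ≉) = inj₂ (record
      { distinct = ≉ ; twin = images-twin agree (level-vert _ k) })
    ... | no  none = inj₁ λ w level →
      let w≈ = vert-index level; k = Fib.from _ (w , level) in
      V.trans (·-cong g (V.sym w≈)) (V.trans
        (decidable-stable (_ ≈? _) (λ ≉ → none (k , ≉)))
        (·-cong h w≈))

  -- Existence of distinct twins

  private
    1<p : 1 < p
    1<p = nonTrivial⇒n>1 p {{prime⇒nonTrivial prime-p}}

    0F 1F : Fin p
    0F = fromℕ< (ℕ.<-trans z<s 1<p)
    1F = fromℕ< 1<p

    1F≢0F : 1F ≢ 0F
    1F≢0F eq with trans (sym (Fin.toℕ-fromℕ< 1<p)) (trans (cong toℕ eq) (Fin.toℕ-fromℕ< _))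
    ... | ()

  module _ (v₀ : Vertex) where

    walk : (ℕ → Fin p) → ℕ → Vertex
    walk f zero    = v₀
    walk f (suc n) = out (walk f n) (f n)

    walk-arc : ∀ f i → walk f i ⟶ walk f (suc i)
    walk-arc f i = out-arc (walk f i) (f i)

    private
      -- bend n fixes base i for i ≤ n and moves base (suc n), so that no two
      -- of the automorphisms bend n agree along the ray base.
      turn : ℕ → ℕ → Fin p
      turn n i with i ℕ.≟ n
      ... | yes _ = 1F
      ... | no  _ = 0F

      turn-≢ : ∀ {n i} → i ≢ n → turn n i ≡ 0F
      turn-≢ {n} {i} i≢n with i ℕ.≟ n
      ... | yes eq = contradiction eq i≢n
      ... | no  _  = refl

      turn-≡ : ∀ n → turn n n ≡ 1F
      turn-≡ n with n ℕ.≟ n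
      ... | yes _  = refl
      ... | no neq = contradiction refl neq

      base : ℕ → Vertex
      base = walk (λ _ → 0F)

      bent : ℕ → ℕ → Vertex
      bent n = walk (turn n)

      bent-≤ : ∀ n i → i ≤ n → bent n i ≡ base i
      bent-≤ n zero    i≤n = refl
      bent-≤ n (suc i) i<n = cong₂ out (bent-≤ n i (ℕ.<⇒≤ i<n)) (turn-≢ (ℕ.<⇒≢ i<n))

      bend : ℕ → Aut Γ
      bend n = proj₁ (hat (suc n) (pathArc _ base (walk-arc _)) (pathArc _ (bent n) (walk-arc _)))

      bend-base : ∀ n i → i ≤ suc n → bend n · base i ≈ bent n i
      bend-base n i i≤ = subst (λ j → bend n · base j ≈ bent n j) (Fin.toℕ-fromℕ< (s≤s i≤))
        (proj₂ (hat (suc n) (pathArc _ base (walk-arc _)) (pathArc _ (bent n) (walk-arc _)))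
               (fromℕ< (s≤s i≤)))

      bend-fixes : ∀ n i → i ≤ n → bend n · base i ≈ base i
      bend-fixes n i i≤n = V.trans (bend-base n i (ℕ.m≤n⇒m≤1+n i≤n)) (V.reflexive (bent-≤ n i i≤n))

      -- Both vertices are out-neighbours of `base n`, one with index `1F` and the other with index
      -- `0F`.
      bend-moves : ∀ n → ¬ bend n · base (suc n) ≈ base (suc n)
      bend-moves n eq = 1F≢0F (out-injective (V.trans (V.sym
        (V.trans (bend-base n (suc n) ℕ.≤-refl)
                 (V.reflexive (cong₂ out (bent-≤ n n ℕ.≤-refl) (turn-≡ n))))) eq))

      z₀ : ℤ
      z₀ = φ.to v₀

      bend-level : ∀ n {z v} → φ.to v ≡ z → φ.to (bend n · v) ≡ z
      bend-level n {v = v} eq =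
        trans (preserves-level φ (bend n) connected (bend-fixes n 0 z≤n) v) eq

      -- Since `bend n` fixes `v₀`, it preserves levels and hence maps the fibre of `v₀` to itself;
      -- this is that action, written in indices.
      restrict : ℕ → Fin m → Fin m
      restrict n k = Fib.from z₀ (bend n · vert z₀ k , bend-level n (level-vert z₀ k))

      agree₀ : ∀ {i j} → restrict i ≗ restrict j → Agree (bend i) (bend j) z₀
      agree₀ {i} {j} eq w level =
        let w≈ = vert-index level in
        V.trans (·-cong (bend i) (V.sym w≈)) (V.trans
          (from-injective (fibres z₀) (eq (Fib.from z₀ (w , level))))
          (·-cong (bend j) w≈))

      -- Agreement on the fibre of `v₀` is carried upwards one level at a time; the first failure
      -- produces twins.
      agree-along : ∀ {i j} → restrict i ≗ restrict j → ∀ n →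
                    Agree (bend i) (bend j) (φ.to (base n)) ⊎ DistinctTwins
      agree-along {i} {j} eq zero = inj₁ (agree₀ {i} {j} eq)
      agree-along {i} {j} eq (suc n) = [ step , inj₂ ]′ (agree-along {i} {j} eq n)
        where
        step : Agree (bend i) (bend j) (φ.to (base n)) →
               Agree (bend i) (bend j) (φ.to (base (suc n))) ⊎ DistinctTwins
        step agree = map₁ (subst (Agree (bend i) (bend j)) (sym (φ.preserves (walk-arc _ n))))
                          (agree-step (bend i) (bend j) _ agree)

    private
      coincidence : ∃[ i ] ∃[ j ] i < j × restrict i ≗ restrict j
      coincidence =
        -- There are `m ^ m` self-maps of `Fin m`, so one more automorphism than that forces a
        -- repetition.
        let i , j , i<j , eq = pigeonhole (ℕ.n<1+n (m ^ m)) (λ i → funToFin (restrict (toℕ i)))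
        in toℕ i , toℕ j , i<j , funToFin-injective (restrict (toℕ i)) (restrict (toℕ j)) eq

    distinctTwins : DistinctTwins
    distinctTwins =
      let i , j , i<j , eq = coincidence in conclude i j i<j (agree-along {i} {j} eq (suc i))
      where
      conclude : ∀ i j → i < j → Agree (bend i) (bend j) (φ.to (base (suc i))) ⊎ DistinctTwins →
                 DistinctTwins
      conclude i j i<j (inj₂ tw)    = tw
      -- As `suc i` is at most `j`, `bend j` fixes `base (suc i)`, whereas `bend i` moves it.
      conclude i j i<j (inj₁ agree) = contradiction
        (V.trans (agree (base (suc i)) refl) (bend-fixes j (suc i) i<j)) (bend-moves i)

  -- Twin classes among the out-neighbours of a vertex

  module _ (v : Vertex) where

    private
      z : ℤ
      z = φ.to v

    incidence : Vertex → Fin m → Fin 2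
    incidence u k = bit (vert z k ⟶? u)

    -- Encodes the set of in-neighbours, for an out-neighbour of v.
    key : Vertex → Fin (2 ^ m)
    key u = funToFin (incidence u)

    twin-key : ∀ {u u′} → Twin u u′ → key u ≡ key u′
    twin-key tw = funToFin-cong (λ k → bit-cong _ _ (tw (vert z k)))

    -- The arc from `v` puts all in-neighbours of `u` at the level of `v`, which is the only level
    -- that the key records.
    key-mono : ∀ {u u′} → v ⟶ u → key u ≡ key u′ → ∀ {w} → w ⟶ u → w ⟶ u′
    key-mono {u} {u′} v⟶u eq {w} w⟶u =
      respˡ w≈ (bit-≡ (vert z i ⟶? u) (vert z i ⟶? u′)
        (funToFin-injective (incidence u) (incidence u′) eq i) (respˡ (V.sym w≈) w⟶u))
      where
      level : φ.to w ≡ z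
      level = source-level φ w⟶u (φ.preserves v⟶u)
      i : Fin m
      i = Fib.from z (w , level)
      w≈ : vert z i ≈ w
      w≈ = vert-index level

    key-twin : ∀ {u u′} → v ⟶ u → v ⟶ u′ → key u ≡ key u′ → Twin u u′
    key-twin v⟶u v⟶u′ eq w = mk⇔ (key-mono v⟶u eq) (key-mono v⟶u′ (sym eq))

    keyOut : Fin p → Fin (2 ^ m)
    keyOut i = key (out v i)

    class : Fin p → Setoid _ _
    class k = Subset (setoid (Fin p)) (λ i → keyOut i ≡ keyOut k)

    size : Fin p → ℕ
    size k = count (λ i → keyOut i Fin.≟ keyOut k)

    class-card : ∀ k → HasCardinality (class k) (size k)
    class-card k = count-card (λ i → keyOut i Fin.≟ keyOut k)

    -- An automorphism taking the arc to `out v j` onto the arc to `out v k` fixes `v`. It therefore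
    -- permutes the out-neighbours of `v`, and it respects twins.
    class-↣ : ∀ j k → Injection (class j) (class k)
    class-↣ j k
      with g , gv≈v , gj≈k ← arc-transitive (out-arc v j) (out-arc v k) = record
      { to        = λ (i , eq) → f i , (begin
          keyOut (f i)       ≡⟨ twin-key (≈⇒twin (f-spec i)) ⟩
          -- The key depends on the numbering of the fibre and need not be invariant under `g`, so
          -- the argument passes through the twin relation.
          key (g · out v i)  ≡⟨ twin-key (twin-aut g (key-twin (out-arc _ _) (out-arc _ _) eq)) ⟩
          key (g · out v j)  ≡⟨ twin-key (≈⇒twin gj≈k) ⟩
          keyOut k           ∎)
      ; cong      = cong f
      ; injective = λ {x} {y} eq → out-injective (aut-injective φ g
          (V.trans (V.sym (f-spec (proj₁ x)))
            (V.trans (V.reflexive (cong (out v) eq)) (f-spec (proj₁ y)))))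
      }
      where
      open ≡-Reasoning
      g-arc : ∀ i → v ⟶ g · out v i
      g-arc i = respˡ gv≈v (·-arc g (out-arc v i))
      f : Fin p → Fin p
      f i = Out.from v (_ , g-arc i)
      f-spec : ∀ i → out v (f i) ≈ g · out v i
      f-spec i = out-index (g-arc i)

    size-≡ : ∀ j k → size j ≡ size k
    size-≡ j k = ℕ.≤-antisym
      (card-≤ (class-card j) (class-card k) (class-↣ j k))
      (card-≤ (class-card k) (class-card j) (class-↣ k j))

    size-≢1 : ∀ {j k} → j ≢ k → keyOut j ≡ keyOut k → size k ≢ 1
    size-≢1 {j} {k} j≢k eq size≡1 = j≢k (from-injective (class-card k) {j , eq} {k , refl}
      (Fin1-prop size≡1 _ _))
      where
      Fin1-prop : ∀ {n} → n ≡ 1 → (i j : Fin n) → i ≡ j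
      Fin1-prop refl zero zero = refl

    -- All classes have equal size, so that size divides the prime `p`. The two distinct members `j`
    -- and `k` rule out size 1, and a class of size `p` is everything.
    keyOut-constant : ∀ {j k} → j ≢ k → keyOut j ≡ keyOut k → ∀ i → keyOut i ≡ keyOut k
    keyOut-constant {j} {k} j≢k eq = [ (λ size≡1 → contradiction size≡1 (size-≢1 j≢k eq))
                                     , count-full (λ i → keyOut i Fin.≟ keyOut k)
                                     ]′ (prime⇒irreducible prime-p size∣p)
      where
      size∣p : size k ∣ p
      size∣p = ∣-uniform-fibres keyOut (λ i → size-≡ i k)

    outs-twin : ∀ {u₁ u₂} → v ⟶ u₁ → v ⟶ u₂ → ¬ u₁ ≈ u₂ → Twin u₁ u₂ →
                ∀ {u u′} → v ⟶ u → v ⟶ u′ → Twin u u′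
    outs-twin {u₁} {u₂} v⟶u₁ v⟶u₂ u₁≉u₂ tw v⟶u v⟶u′ =
      twin-resp (out-index v⟶u) (out-index v⟶u′)
        (key-twin (out-arc _ _) (out-arc _ _) (trans (constant _) (sym (constant _))))
      where
      constant : ∀ i → keyOut i ≡ keyOut (Out.from v (u₂ , v⟶u₂))
      constant = keyOut-constant (u₁≉u₂ ∘ from-injective (outs v))
        (twin-key (twin-resp (V.sym (out-index v⟶u₁)) (V.sym (out-index v⟶u₂)) tw))

  outs-twin-somewhere : Vertex → ∃[ v ] (∀ {u u′} → v ⟶ u → v ⟶ u′ → Twin u u′)
  outs-twin-somewhere v₀ =
    let open DistinctTwins (distinctTwins v₀) renaming (u to u₁; v to u₂)
        -- Being twins does not by itself supply a common in-neighbour. Moving `out v₀ 0F` to `u₁`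
        -- makes the image of `v₀` one.
        g , eq = vertex-transitive (out v₀ 0F) u₁
        v⟶u₁ = respʳ eq (·-arc g (out-arc v₀ 0F))
    in g · v₀ , outs-twin (g · v₀) v⟶u₁ (Equivalence.to (twin _) v⟶u₁) distinct twin

  -- Vertex-transitivity moves `v` to the one vertex whose out-neighbours are known to be twins.
  -- Exchanging `u` and `u′` gives the reverse inclusion.
  out-mono : ∀ {v u u′} → v ⟶ u → v ⟶ u′ → ∀ {w} → w ⟶ u → w ⟶ u′
  out-mono {v} v⟶u v⟶u′ {w} w⟶u =
    let v₁ , twins = outs-twin-somewhere v
        g , gv≈v₁ = vertex-transitive v v₁
        image : ∀ {x} → v ⟶ x → v₁ ⟶ g · x
        image v⟶x = respˡ gv≈v₁ (·-arc g v⟶x)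
    in aut-reflects φ g (Equivalence.to (twins (image v⟶u) (image v⟶u′) (g · w)) (·-arc g w⟶u))

  -- In-valency

  in-↣ : ∀ u u′ → Injection (Subset vertices (_⟶ u)) (Subset vertices (_⟶ u′))
  in-↣ u u′ = let g , gu≈u′ = vertex-transitive u u′ in record
    { to        = λ (w , w⟶u) → g · w , respʳ gu≈u′ (·-arc g w⟶u)
    ; cong      = ·-cong g
    ; injective = aut-injective φ g
    }

  -- Double counting of the arcs between two consecutive fibres, both of size `m`: out-valencies
  -- give `m * p`, and in-valencies, equal by vertex-transitivity, give `m` times the in-valency of
  -- `t`.
  ins : ∀ {s t} → s ⟶ t → HasCardinality (Subset vertices (_⟶ t)) p
  ins {s} {t} s⟶t = subst (HasCardinality _) d≡p (in-card (φ.preserves s⟶t))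
    where
    z z⁺ : ℤ
    z  = φ.to s
    z⁺ = z ℤ.+ 1ℤ

    in-card : ∀ {u} → φ.to u ≡ z⁺ →
              HasCardinality (Subset vertices (_⟶ u)) (count (λ j → vert z j ⟶? u))
    in-card {u} level = level-card z respˡ (_⟶? u) (λ a → source-level φ a level)

    row : ∀ j → count (λ k → vert z j ⟶? vert z⁺ k) ≡ p
    row j = card-unique
      (level-card z⁺ respʳ (vert z j ⟶?_)
        (λ a → trans (φ.preserves a) (cong (ℤ._+ 1ℤ) (level-vert z j))))
      (outs (vert z j))

    column : ∀ k → count (λ j → vert z j ⟶? vert z⁺ k) ≡ count (λ j → vert z j ⟶? t)
    column k = ℕ.≤-antisym
      (card-≤ (in-card (level-vert z⁺ k)) (in-card (φ.preserves s⟶t)) (in-↣ (vert z⁺ k) t))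
      (card-≤ (in-card (φ.preserves s⟶t)) (in-card (level-vert z⁺ k)) (in-↣ t (vert z⁺ k)))

    -- The fibre of level `z` contains `s`, which allows cancelling `m`.
    instance
      m≢0 : NonZero m
      m≢0 = Fin.nonZeroIndex (Fib.from z (s , refl))

    d≡p : count (λ j → vert z j ⟶? t) ≡ p
    d≡p = ℕ.*-cancelˡ-≡ _ _ m (begin
      m * count (λ j → vert z j ⟶? t)                       ≡⟨ sum-const m _ ⟨
      sum {m} (λ _ → count (λ j → vert z j ⟶? t))           ≡⟨ sum-cong-≗ column ⟨
      sum (λ k → count (λ j → vert z j ⟶? vert z⁺ k))
        ≡⟨ ∑-comm (λ k j → indicator (vert z j ⟶? vert z⁺ k)) ⟩
      sum (λ j → count (λ k → vert z j ⟶? vert z⁺ k))       ≡⟨ sum-cong-≗ row ⟩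
      sum {m} (λ _ → p)                                     ≡⟨ sum-const m p ⟩
      m * p                                                 ∎)
      where open ≡-Reasoning

  -- Alternets

  module _ (x : Arc Γ) where
    open Arc x renaming (source to s; target to t; isArc to s⟶t)
    private
      module A = Digraph (Alternet Γ x)
      module I = Inverse (ins s⟶t)
      module O = Inverse (outs s)

    -- An invariant bounding the class of `x` from above; `reach` shows that the bound is attained.
    InBlock : Arc Γ → Set e
    InBlock y = Arc.source y ⟶ t × s ⟶ Arc.target y

    -- With a common source, the target of `z` and `t` have a common in-neighbour, hence the same
    -- in-neighbours, among them `s`. With a common target, that target and `t` are both
    -- out-neighbours of `s`, so the source of `z` also points to `t`.
    related-InBlock : ∀ {y z} → Related Γ y z → InBlock y → InBlock z
    related-InBlock {z = z} (inj₁ same-source) (a , _) =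
      let a′ = respˡ same-source a in a′ , out-mono a′ (Arc.isArc z) s⟶t
    related-InBlock {z = z} (inj₂ same-target) (_ , b) =
      let b′ = respʳ same-target b in out-mono b′ s⟶t (Arc.isArc z) , b′

    reachable-InBlock : ∀ {y z} → Reachable Γ y z → InBlock y → InBlock z
    reachable-InBlock {y} {z} [ r ] = related-InBlock {y} {z} r
    reachable-InBlock {y} (_∷_ {y = w} r rs) = reachable-InBlock rs ∘ related-InBlock {y} {w} r

    InBlock-arc : ∀ {u v} → u ⟶ t → s ⟶ v → u ⟶ v
    InBlock-arc u⟶t s⟶v = out-mono s⟶t s⟶v u⟶t

    reach : ∀ {u v} (u⟶t : u ⟶ t) (s⟶v : s ⟶ v) →
            Reachable Γ x (record { isArc = InBlock-arc u⟶t s⟶v })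
    reach u⟶t s⟶v =
      -- The intermediate arc from `u` to `t` shares its target with `x` and its source with the arc
      -- from `u` to `v`.
      _∷_ {y = record { isArc = u⟶t }} (inj₂ V.refl) [ inj₁ V.refl ]

    side : (v : A.Vertex) → proj₁ v ⟶ t ⊎ s ⟶ proj₁ v
    side (_ , _ , r , inj₁ eq) = inj₁ (respˡ eq (proj₁ (reachable-InBlock r (s⟶t , s⟶t))))
    side (_ , _ , r , inj₂ eq) = inj₂ (respʳ eq (proj₂ (reachable-InBlock r (s⟶t , s⟶t))))

    clash : ∀ {v w} → v ≈ w → v ⟶ t → s ⟶ w → ⊥
    clash v≈w v⟶t s⟶w = no-shortcut φ s⟶w (respˡ v≈w v⟶t) s⟶t

    index : ∀ {v} → v ⟶ t ⊎ s ⟶ v → Fin p ⊎ Fin p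
    index (inj₁ v⟶t) = inj₁ (I.from (_ , v⟶t))
    index (inj₂ s⟶v) = inj₂ (O.from (_ , s⟶v))

    -- The index is computed from a proof of the side, not from the vertex alone. It is well defined
    -- because `clash` forces the side and `from-cong` forgets the witness.
    index-cong : ∀ {v w} (a : v ⟶ t ⊎ s ⟶ v) (b : w ⟶ t ⊎ s ⟶ w) → v ≈ w → index a ≡ index b
    index-cong (inj₁ _) (inj₁ _) v≈w = cong inj₁ (I.from-cong v≈w)
    index-cong (inj₁ a) (inj₂ b) v≈w = contradiction b (clash v≈w a)
    index-cong (inj₂ a) (inj₁ b) v≈w = contradiction a (clash (V.sym v≈w) b)
    index-cong (inj₂ _) (inj₂ _) v≈w = cong inj₂ (O.from-cong v≈w)

    unindex : Fin p ⊎ Fin p → A.Vertex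
    unindex (inj₁ i) = let v , v⟶t = I.to i in v , _ , reach v⟶t s⟶t , inj₁ V.refl
    unindex (inj₂ j) = let v , s⟶v = O.to j in v , _ , reach s⟶t s⟶v , inj₂ V.refl

    unindex-side : ∀ k → proj₁ (unindex k) ⟶ t ⊎ s ⟶ proj₁ (unindex k)
    unindex-side (inj₁ i) = inj₁ (proj₂ (I.to i))
    unindex-side (inj₂ j) = inj₂ (proj₂ (O.to j))

    index-unindex : ∀ k → index (unindex-side k) ≡ k
    index-unindex (inj₁ i) = cong inj₁ (I.strictlyInverseʳ i)
    index-unindex (inj₂ j) = cong inj₂ (O.strictlyInverseʳ j)

    unindex-index : ∀ {v} (a : v ⟶ t ⊎ s ⟶ v) → proj₁ (unindex (index a)) ≈ v
    unindex-index (inj₁ a) = I.strictlyInverseˡ (_ , a)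
    unindex-index (inj₂ a) = O.strictlyInverseˡ (_ , a)

    alternet≅K⃗ : Alternet Γ x ≅ K⃗ p p
    alternet≅K⃗ = record
      { inverse = record
        { to        = index ∘ side
        ; from      = unindex
        ; to-cong   = λ {u} {v} → index-cong (side u) (side v)
        ; from-cong = λ { refl → V.refl }
        ; inverse   = (λ {k} {v} v≈ → trans (index-cong (side v) (unindex-side k) v≈) (index-unindex k))
                    , (λ { {v} refl → unindex-index (side v) })
        }
      ; arcs = λ {u} {v} → mk⇔ (arcs-to (side u) (side v)) (arcs-from (side u) (side v))
      }
      where
      arcs-to : ∀ {u v} (a : u ⟶ t ⊎ s ⟶ u) (b : v ⟶ t ⊎ s ⟶ v) →
                (∃[ y ] Reachable Γ x y × Arc.source y ≈ u × Arc.target y ≈ v) →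
                BipartiteArc p p (index a) (index b)
      arcs-to a b (y , r , su , tv) with reachable-InBlock r (s⟶t , s⟶t)
      arcs-to (inj₁ a) (inj₂ b) _                | _         = arc _ _
      -- Arcs of the class start at in-neighbours of `t` and end at out-neighbours of `s`, so every
      -- other combination of sides is a clash.
      arcs-to (inj₂ a) _        (y , r , su , tv) | y⟶t , _  = contradiction a (clash su y⟶t)
      arcs-to (inj₁ _) (inj₁ b) (y , r , su , tv) | _ , s⟶y = contradiction s⟶y (clash (V.sym tv) b)

      arcs-from : ∀ {u v} (a : u ⟶ t ⊎ s ⟶ u) (b : v ⟶ t ⊎ s ⟶ v) →
                  BipartiteArc p p (index a) (index b) →
                  ∃[ y ] Reachable Γ x y × Arc.source y ≈ u × Arc.target y ≈ v
      arcs-from (inj₁ a) (inj₂ b) _ = _ , reach a b , V.refl , V.refl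

corollary14 : ∀ {c ℓ e} (Γ : Digraph c ℓ e) (p m : ℕ) →
    TwoEnded Γ →
    HighlyArcTransitive Γ →
    Prime p →
    HasOutValency Γ p →
    (φ : Hom Γ ℤ⃗) →
    IsSurjective φ →
    (∀ (i : ℤ) → HasCardinality (Fibre φ i) m) →
    m > 2 →
    ∀ (x : Arc Γ) → Alternet Γ x ≅ K⃗ p p
corollary14 Γ p m (connected , _) hat prime-p outs φ _ fibres _ x =
  alternet≅K⃗ connected hat prime-p outs φ fibres x
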